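{- Let $\mathcal T$ be a distributed theory. (a) For $\sigma\in\{\textsf{Sup},\textsf{St}\}$ and every universally consistent DPWS $\mathcal Q$: $\mathcal Q$ is a $\sigma$-model of $\mathcal T$ iff $\tau_{\mathit{pws}}(\mathcal Q)$ is a $\sigma$-model of $\tau_{\mathit{theory}}(\mathcal T)$. (b) For every universally consistent distributed belief pair $\mathcal B$: $\mathcal B$ is a PSt-model of $\mathcal T$ iff $\tau_{\mathit{beliefpair}}(\mathcal B)$ is a PSt-model of $\tau_{\mathit{theory}}(\mathcal T)$.
   Context: Standing setup (dAEL). $\Sigma=\Sigma_o\uplus\Sigma_s$ is a first-order vocabulary (objective and subjective symbols). A nonempty domain $D$ and a $\Sigma_o$-structure $I_o$ with domain $D$ are fixed, as is a set of agents $\mathcal{A}\subseteq D$. For each $A\in\mathcal{A}$ there is a constant $A\in\Sigma_o$ with $A^{I_o}=A$, and $\Sigma_o$ contains a unary predicate $\mathrm{Apred}$ with $\mathrm{Apred}^{I_o}=\mathcal{A}$. "Structure" means a $\Sigma$-structure with domain $D$ that agrees with $I_o$ on $\Sigma_o$. Formulas of dAEL are built from atoms $P(\bar t)$ ($P\in\Sigma$ or equality) using $\wedge,\neg,\forall x$, and the modal rule: if $\varphi$ is a formula and $t$ a term then $K_t\varphi$ is a formula ($\vee,\Rightarrow,\Leftrightarrow,\exists$ are the usual abbreviations). Truth values are $\mathbf t,\mathbf f,\mathbf u$ with truth order $\mathbf f<_t\mathbf u<_t\mathbf t$; $\mathbf t^{ -1}=\mathbf f$, $\mathbf f^{ -1}=\mathbf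 t$, $\mathbf u^{ -1}=\mathbf u$. A possible world structure (PWS) is a set of structures; $Q_1\le_K Q_2$ iff $Q_2\subseteq Q_1$; $\bot$ denotes the set of all structures and $\top=\emptyset$. A distributed possible world structure (DPWS) is a family $\mathcal Q=(\mathcal Q_A)_{A\in\mathcal A}$ of PWSs, ordered pointwise by $\le_K$. A distributed belief pair (DBP) is a pair $\mathcal B=(\mathcal B^c,\mathcal B^l)$ of DPWSs; $(\mathcal P,\mathcal S)\le_p(\mathcal P',\mathcal S')$ iff $\mathcal P\le_K\mathcal P'$ and $\mathcal S'\le_K\mathcal S$. A DBP is consistent if $\mathcal B^c\le_K\mathcal B^l$ (i.e. $\mathcal B^l_A\subseteq\mathcal B^c_A$ for all $A$); DBPs are tacitly assumed consistent unless said otherwise, and a DPWS $\mathcal Q$ is identified with the exact DBP $(\mathcal Q,\mathcal Q)$. Two-valued value $\varphi^{\mathcal Q,I,a}$ (DPWS $\mathcal Q$, structure $I$, variable assignment $a$): standard first-order clauses for atoms, $\neg,\wedge,\forall$, and $(K_t\varphi)^{\mathcal Q,I,a}=\mathbf t$ iff $t^{I,a}\in\mathcal A$ and $\varphi^{\mathcal Q,J,a}=\mathbf t$ for every $J\in\mathcal Q_{t^{I,a}}$, otherwise $\mathbf f$. Three-valued value $\varphi^{\mathcal B,I,a}$ for any pair $\mathcal B$ of DPWSs: atoms get their two-valued value in $I$; $\neg$ is interpreted by ${}^{ -1}$, and $\wedge$, $\forall$ by $\le_t$-greatest lower bound (Kleene); $(K_t\varphi)^{\mathcal B,I,a}$ is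 $\mathbf t$ if $t^{I,a}\in\mathcal A$ and $\varphi^{\mathcal B,J,a}=\mathbf t$ for all $J\in\mathcal B^c_{t^{I,a}}$; it is $\mathbf f$ if $t^{I,a}\notin\mathcal A$ or $\varphi^{\mathcal B,J,a}=\mathbf f$ for some $J\in\mathcal B^l_{t^{I,a}}$; and $\mathbf u$ otherwise. For sentences the assignment is omitted, and the value of a set of sentences is the $\le_t$-glb of the values of its members. A distributed theory is a family $\mathcal T=(\mathcal T_A)_{A\in\mathcal A}$ of sets of dAEL sentences. Operators: $D_{\mathcal T}(\mathcal Q)=(\{I:\mathcal T_A^{\mathcal Q,I}=\mathbf t\})_{A\in\mathcal A}$; $D^*_{\mathcal T}(\mathcal B)=(D^c_{\mathcal T}(\mathcal B),D^l_{\mathcal T}(\mathcal B))$ with $D^c_{\mathcal T}(\mathcal B)_A=\{I:\mathcal T_A^{\mathcal B,I}\ne\mathbf f\}$ and $D^l_{\mathcal T}(\mathcal B)_A=\{I:\mathcal T_A^{\mathcal B,I}=\mathbf t\}$; the stable operator $S_{\mathcal T}(\mathcal Q)$ is the $\le_K$-least fixpoint of $\mathcal Q'\mapsto D^c_{\mathcal T}((\mathcal Q',\mathcal Q))$. Models of $\mathcal T$ (w.r.t. $I_o$): a Sup-model is a DPWS fixpoint of $D_{\mathcal T}$; the KK-model is the $\le_p$-least fixpoint of $D^*_{\mathcal T}$; a PSt-model is a DBP $\mathcal B$ with $\mathcal B^c=S_{\mathcal T}(\mathcal B^l)$ and $\mathcal B^l=S_{\mathcal T}(\mathcal B^c)$;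 an St-model is a DPWS $\mathcal Q$ such that $(\mathcal Q,\mathcal Q)$ is a PSt-model; the WF-model is the $\le_p$-least PSt-model. Universal consistency: a DPWS $\mathcal Q$ is universally consistent if $\mathcal Q_A\neq\emptyset$ for all $A\in\mathcal A$; a DBP $\mathcal B$ is universally consistent if $\mathcal B^l$ is. Translation to AEL. $\Sigma'$ consists of all symbols of $\Sigma_o$ and all symbols of $\Sigma_s$ with arity increased by one. A fixed element $\delta\in D$ is chosen. A $\Sigma'$-structure always has domain $D$, agrees with $I_o$ on $\Sigma_o$, and is normal: for every $f\in\Sigma_s$, $f^J(\bar d,d)=\delta$ whenever $d\notin\mathcal A$, and for every relation $R\in\Sigma_s$, $(\bar d,d)\notin R^J$ whenever $d\notin\mathcal A$. AEL formulas over $\Sigma'$ are built like dAEL formulas but with a single unindexed modal operator $K$. AEL semantics: a PWS is a set of $\Sigma'$-structures (with $\le_K$ reverse inclusion, $\bot$ the set of all $\Sigma'$-structures, $\top=\emptyset$); a belief pair is a pair $(P,S)$ of PWSs with $S\subseteq P$, with $(P,S)\le_p(P',S')$ iff $P\le_K P'$ and $S'\le_K S$; values $\varphi^{Q,J}$ and $\varphi^{(P,S),J}$ are defined as in dAEL but with $(K\varphi)^{Q,J,a}=\mathbf t$ iff $\varphi^{Q,J',a}=\mathbf t$ for all $J'\in Q$, and $(K\varphi)^{(P,S),J,a}$ equal to $\mathbf t$ if $\varphi$ is $\mathbf t$ at all $J'\in P$, $\mathbf f$ if $\varphi$ is $\mathbf f$ at some $J'\in S$, $\mathbf u$ otherwise.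 For an AEL theory $T$: $D_T(Q)=\{J:T^{Q,J}=\mathbf t\}$, $D^*_T(P,S)=(\{J:T^{(P,S),J}\ne\mathbf f\},\{J:T^{(P,S),J}=\mathbf t\})$, $S_T(Q)$ = $\le_K$-least fixpoint of $Q'\mapsto D^*_T(Q',Q)_1$; Sup-, KK-, PSt-, St-, WF-models are defined from these exactly as in dAEL. For a $\Sigma$-term $t$ and $\Sigma'$-term $s$, $t_s$ is defined by $x_s=x$ for variables, $f(t_1,\dots,t_n)_s=f((t_1)_s,\dots,(t_n)_s,s)$ for $f\in\Sigma_s$, $f(t_1,\dots,t_n)_s=f((t_1)_s,\dots,(t_n)_s)$ for $f\in\Sigma_o$. $\tau_{\mathit{formula}}(s,\cdot)$: $P(t_1,\dots,t_n)\mapsto P((t_1)_s,\dots,(t_n)_s,s)$ if $P\in\Sigma_s$, $P((t_1)_s,\dots,(t_n)_s)$ if $P\in\Sigma_o$ or equality; commutes with $\neg,\wedge,\forall x$; $\tau_{\mathit{formula}}(s,K_t\phi)=\exists x(x=t_s\wedge\mathrm{Apred}(x)\wedge K\,\tau_{\mathit{formula}}(x,\phi))$ for a fresh variable $x$. $\tau_{\mathit{theory}}(\mathcal T)=\bigcup_{A\in\mathcal A}\{\tau_{\mathit{formula}}(A,\phi):\phi\in\mathcal T_A\}$. For a family $(I_A)_{A\in\mathcal A}$ of structures, $\tau_{\mathit{structure}}((I_A)_A)$ is the $\Sigma'$-structure interpreting $\Sigma_o$ as $I_o$, each $f\in\Sigma_s$ by $f(\bar d,d)=f^{I_d}(\bar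 d)$ if $d\in\mathcal A$ and $\delta$ otherwise, and each relation $R\in\Sigma_s$ by $(\bar d,d)\in R$ iff $d\in\mathcal A$ and $\bar d\in R^{I_d}$. $\tau_{\mathit{pws}}(\mathcal Q)=\{\tau_{\mathit{structure}}((I_A)_A): I_A\in\mathcal Q_A\text{ for all }A\in\mathcal A\}$, and $\tau_{\mathit{beliefpair}}(\mathcal B)=(\tau_{\mathit{pws}}(\mathcal B^c),\tau_{\mathit{pws}}(\mathcal B^l))$. -}

module Defs where

open import Level using (0ℓ) renaming (suc to lsuc)
open import Data.Nat.Base using (ℕ; suc)
open import Data.Fin.Base using (Fin; zero; suc; lift)
open import Data.Vec.Base using (Vec; []; _∷_; [_]; lookup; init; last; _∷ʳ_)
open import Data.Vec.Properties using (last-∷ʳ)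
open import Data.Bool.Base using (Bool; false; T)
open import Data.Bool.Properties using (T?; T-irrelevant)
open import Data.Product.Base using (Σ; ∃; _×_; _,_; proj₁)
open import Data.Sum.Base using (_⊎_; inj₁; inj₂)
open import Data.Empty using (⊥)
open import Function.Base using (_∘_)
open import Relation.Nullary.Negation.Core using (¬_; contradiction)
open import Relation.Nullary.Decidable.Core using (yes; no)
open import Relation.Unary using (Pred; _∈_; _⊆_)
open import Relation.Binary.Core using (Rel)
open import Relation.Binary.Definitions using (_Respects_)
open import Relation.Binary.PropositionalEquality.Core
  using (_≡_; refl; sym; trans; cong; cong₂; subst)

------------------------------------------------------------------------
-- First-order vocabularies, terms, atoms

record Vocabulary : Set₁ where
  field
    Fun : ℕ → Set
    Pre : ℕ → Set

open Vocabulary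

_⊎ᵛ_ : Vocabulary → Vocabulary → Vocabulary
(V ⊎ᵛ W) .Fun n = V .Fun n ⊎ W .Fun n
(V ⊎ᵛ W) .Pre n = V .Pre n ⊎ W .Pre n

-- Variables are well-scoped de Bruijn indices: a term or formula over
-- scope n has its free variables in Fin n, and sentences have scope 0.
data Term (V : Vocabulary) (n : ℕ) : Set where
  var : Fin n → Term V n
  fun : ∀ {k} → V .Fun k → Vec (Term V n) k → Term V n

data Atom (V : Vocabulary) (n : ℕ) : Set where
  pre : ∀ {k} → V .Pre k → Vec (Term V n) k → Atom V n
  _≐_ : Term V n → Term V n → Atom V n

module _ {V : Vocabulary} {m n : ℕ} (ρ : Fin m → Fin n) where
  mutual
    rename : Term V m → Term V n
    rename (var x)    = var (ρ x)
    rename (fun f ts) = fun f (renames ts)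

    renames : ∀ {k} → Vec (Term V m) k → Vec (Term V n) k
    renames []       = []
    renames (t ∷ ts) = rename t ∷ renames ts

-- Relations are characteristic functions, as befits two-valued structures;
-- under excluded middle these are the same as arbitrary predicates.
record Interpretation (V : Vocabulary) (D : Set) : Set where
  field
    ⟦_⟧ᶠ : ∀ {k} → V .Fun k → Vec D k → D
    ⟦_⟧ᵖ : ∀ {k} → V .Pre k → Vec D k → Bool

open Interpretation

record _≈ⁱ_ {V : Vocabulary} {D : Set} (I J : Interpretation V D) : Set where
  field
    fun≈ : ∀ {k} (f : V .Fun k) ds → ⟦ I ⟧ᶠ f ds ≡ ⟦ J ⟧ᶠ f ds
    pre≈ : ∀ {k} (P : V .Pre k) ds → ⟦ I ⟧ᵖ P ds ≡ ⟦ J ⟧ᵖ P ds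

open _≈ⁱ_ public

≈ⁱ-sym : ∀ {V D} {I J : Interpretation V D} → I ≈ⁱ J → J ≈ⁱ I
≈ⁱ-sym I≈J .fun≈ f ds = sym (I≈J .fun≈ f ds)
≈ⁱ-sym I≈J .pre≈ P ds = sym (I≈J .pre≈ P ds)

≈ⁱ-trans : ∀ {V D} {I J K : Interpretation V D} → I ≈ⁱ J → J ≈ⁱ K → I ≈ⁱ K
≈ⁱ-trans p q .fun≈ f ds = trans (p .fun≈ f ds) (q .fun≈ f ds)
≈ⁱ-trans p q .pre≈ P ds = trans (p .pre≈ P ds) (q .pre≈ P ds)

module _ {V : Vocabulary} {D : Set} where
  module _ (I : Interpretation V D) {n : ℕ} (a : Vec D n) where
    mutual
      eval : Term V n → D
      eval (var x)    = lookup a x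
      eval (fun f ts) = ⟦ I ⟧ᶠ f (evals ts)

      evals : ∀ {k} → Vec (Term V n) k → Vec D k
      evals []       = []
      evals (t ∷ ts) = eval t ∷ evals ts

    Holds : Atom V n → Set
    Holds (pre P ts) = T (⟦ I ⟧ᵖ P (evals ts))
    Holds (s ≐ t)    = eval s ≡ eval t

  module _ {I J : Interpretation V D} (I≈J : I ≈ⁱ J) {n : ℕ} (a : Vec D n) where
    mutual
      eval-cong : ∀ t → eval I a t ≡ eval J a t
      eval-cong (var x)    = refl
      eval-cong (fun f ts) =
        trans (I≈J .fun≈ f (evals I a ts)) (cong (⟦ J ⟧ᶠ f) (evals-cong ts))

      evals-cong : ∀ {k} (ts : Vec (Term V n) k) → evals I a ts ≡ evals J a ts
      evals-cong []       = refl
      evals-cong (t ∷ ts) = cong₂ _∷_ (eval-cong t) (evals-cong ts)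

    holds-cong : ∀ α → Holds I a α → Holds J a α
    holds-cong (pre P ts) = subst T
      (trans (I≈J .pre≈ P (evals I a ts)) (cong (⟦ J ⟧ᵖ P) (evals-cong ts)))
    holds-cong (s ≐ t) eq =
      trans (sym (eval-cong s)) (trans eq (eval-cong t))

------------------------------------------------------------------------
-- Possible world structures and the knowledge order

-- A set of worlds, worlds being identified along _≈_ (there are no quotients
-- and no function extensionality, so ≈ plays the role of equality).
record PowerSet {W : Set} (_≈_ : Rel W 0ℓ) : Set₁ where
  field
    worlds   : Pred W 0ℓ
    respects : worlds Respects _≈_

open PowerSet public

module _ {W : Set} {_≈_ : Rel W 0ℓ} where
  infix 4 _≤ᴷ_

  _≤ᴷ_ : Rel (PowerSet _≈_) 0ℓ
  P ≤ᴷ Q = worlds Q ⊆ worlds P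

-- For a preorder _≤_, with equality meaning ≤ in both directions.
module _ {a ℓ} {X : Set a} (_≤_ : Rel X ℓ) where

  IsFixpoint : (X → X) → Pred X ℓ
  IsFixpoint F x = F x ≤ x × x ≤ F x

  IsLeastFixpoint : (X → X) → Pred X _
  IsLeastFixpoint F x = IsFixpoint F x × (∀ y → IsFixpoint F y → x ≤ y)

------------------------------------------------------------------------
-- The fixed data

record Setting : Set₁ where
  field
    Σₒ Σₛ : Vocabulary
    D     : Set
    δ     : D  -- also witnesses that D is nonempty
    Iₒ    : Interpretation Σₒ D
    agent : D → Bool  -- characteristic function of the set of agents

  -- Elements of the set of agents; T (agent d) has at most one proof.
  Agent : Set
  Agent = Σ D (T ∘ agent)

  field
    name          : Agent → Σₒ .Fun 0
    name-correct  : ∀ A → ⟦ Iₒ ⟧ᶠ (name A) [] ≡ proj₁ A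
    Apred         : Σₒ .Pre 1
    Apred-correct : ∀ d → ⟦ Iₒ ⟧ᵖ Apred [ d ] ≡ agent d

------------------------------------------------------------------------
-- Distributed autoepistemic logic

module DAEL (S : Setting) where
  open Setting S

  Voc : Vocabulary
  Voc = Σₒ ⊎ᵛ Σₛ

  data Formula (n : ℕ) : Set where
    atom : Atom Voc n → Formula n
    ¬′_  : Formula n → Formula n
    _∧′_ : Formula n → Formula n → Formula n
    ∀′_  : Formula (suc n) → Formula n
    K    : Term Voc n → Formula n → Formula n

  Sentence : Set
  Sentence = Formula 0

  record Structure : Set where
    field
      interp  : Interpretation Voc D
      agreesᶠ : ∀ {k} (f : Σₒ .Fun k) ds → ⟦ interp ⟧ᶠ (inj₁ f) ds ≡ ⟦ Iₒ ⟧ᶠ f ds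
      agreesᵖ : ∀ {k} (P : Σₒ .Pre k) ds → ⟦ interp ⟧ᵖ (inj₁ P) ds ≡ ⟦ Iₒ ⟧ᵖ P ds

  open Structure public

  _≈_ : Rel Structure 0ℓ
  I ≈ J = interp I ≈ⁱ interp J

  PWS : Set₁
  PWS = PowerSet _≈_

  DPWS : Set₁
  DPWS = Agent → PWS

  infix 4 _≤_
  _≤_ : Rel DPWS 0ℓ
  Q₁ ≤ Q₂ = ∀ A → Q₁ A ≤ᴷ Q₂ A

  record DBP : Set₁ where
    field
      conservative liberal : DPWS
      consistent           : conservative ≤ liberal

  open DBP public

  exact : DPWS → DBP
  exact Q = record
    { conservative = Q ; liberal = Q ; consistent = λ _ I∈Q → I∈Q }

  UniversallyConsistent : Pred DPWS 0ℓ
  UniversallyConsistent Q = ∀ A → ∃ λ I → I ∈ worlds (Q A)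

  UniversallyConsistentDBP : Pred DBP 0ℓ
  UniversallyConsistentDBP B = UniversallyConsistent (liberal B)

  -- True φ Q I a : the two-valued value of φ is 𝐭 (otherwise it is 𝐟).
  True : ∀ {n} → Formula n → DPWS → Structure → Vec D n → Set
  True (atom α) Q I a = Holds (interp I) a α
  True (¬′ φ)   Q I a = ¬ True φ Q I a
  True (φ ∧′ ψ) Q I a = True φ Q I a × True ψ Q I a
  True (∀′ φ)   Q I a = ∀ d → True φ Q I (d ∷ a)
  True (K t φ)  Q I a = let d = eval (interp I) a t in
    Σ (T (agent d)) λ p → ∀ J → J ∈ worlds (Q (d , p)) → True φ Q J a

  -- The three-valued value of φ in the pair (P , S), with P conservative and
  -- S liberal, is given by the clauses for "the value is 𝐭" (True³) and
  -- "the value is 𝐟" (False³); it is 𝐮 when neither applies.  In a consistent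
  -- pair at most one of them applies (see `exclusive`).  The stable operator
  -- also needs inconsistent pairs, in which both clauses for K may apply.
  -- There "≠ 𝐟" is read as ¬ False³: this is the usual extension of the
  -- approximating operator to the whole bilattice of pairs, for which
  -- P ↦ Dᶜ (P , S) is monotone.
  mutual
    True³ : ∀ {n} → Formula n → (P S : DPWS) → Structure → Vec D n → Set
    True³ (atom α) P S I a = Holds (interp I) a α
    True³ (¬′ φ)   P S I a = False³ φ P S I a
    True³ (φ ∧′ ψ) P S I a = True³ φ P S I a × True³ ψ P S I a
    True³ (∀′ φ)   P S I a = ∀ d → True³ φ P S I (d ∷ a)
    True³ (K t φ)  P S I a = let d = eval (interp I) a t in
      Σ (T (agent d)) λ p → ∀ J → J ∈ worlds (P (d , p)) → True³ φ P S J a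

    False³ : ∀ {n} → Formula n → (P S : DPWS) → Structure → Vec D n → Set
    False³ (atom α) P S I a = ¬ Holds (interp I) a α
    False³ (¬′ φ)   P S I a = True³ φ P S I a
    False³ (φ ∧′ ψ) P S I a = False³ φ P S I a ⊎ False³ ψ P S I a
    False³ (∀′ φ)   P S I a = ∃ λ d → False³ φ P S I (d ∷ a)
    False³ (K t φ)  P S I a = let d = eval (interp I) a t in
      (¬ T (agent d)) ⊎
      (Σ (T (agent d)) λ p → ∃ λ J → J ∈ worlds (S (d , p)) × False³ φ P S J a)

  exclusive : ∀ {n} (φ : Formula n) {P S : DPWS} → P ≤ S → ∀ {I a} →
              True³ φ P S I a → False³ φ P S I a → ⊥
  exclusive (atom α) c t        f         = f t
  exclusive (¬′ φ)   c t        f         = exclusive φ c f t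
  exclusive (φ ∧′ ψ) c (t , _)  (inj₁ f)  = exclusive φ c t f
  exclusive (φ ∧′ ψ) c (_ , t)  (inj₂ f)  = exclusive ψ c t f
  exclusive (∀′ φ)   c t        (d , f)   = exclusive φ c (t d) f
  exclusive (K t φ)  c (p , _)  (inj₁ ¬p) = ¬p p
  exclusive (K t φ)  c (p , ts) (inj₂ (q , J , J∈S , f))
    with refl ← T-irrelevant p q = exclusive φ c (ts J (c _ J∈S)) f

  True-resp : ∀ {n} (φ : Formula n) {Q I J a} → I ≈ J →
              True φ Q I a → True φ Q J a
  True-resp (atom α) {a = a} e h = holds-cong e a α h
  True-resp (¬′ φ) e h h′ = h (True-resp φ (≈ⁱ-sym e) h′)
  True-resp (φ ∧′ ψ) e (h , h′) = True-resp φ e h , True-resp ψ e h′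
  True-resp (∀′ φ) e h d = True-resp φ e (h d)
  True-resp (K t φ) {Q} {a = a} e = subst
    (λ d → Σ (T (agent d)) λ p → ∀ J → J ∈ worlds (Q (d , p)) → True φ Q J a)
    (eval-cong e a t)

  mutual
    True³-resp : ∀ {n} (φ : Formula n) {P S I J a} → I ≈ J →
                 True³ φ P S I a → True³ φ P S J a
    True³-resp (atom α) {a = a} e h = holds-cong e a α h
    True³-resp (¬′ φ) e h = False³-resp φ e h
    True³-resp (φ ∧′ ψ) e (h , h′) = True³-resp φ e h , True³-resp ψ e h′
    True³-resp (∀′ φ) e h d = True³-resp φ e (h d)
    True³-resp (K t φ) {P} {S} {a = a} e = subst
      (λ d → Σ (T (agent d)) λ p → ∀ J → J ∈ worlds (P (d , p)) → True³ φ P S J a)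
      (eval-cong e a t)

    False³-resp : ∀ {n} (φ : Formula n) {P S I J a} → I ≈ J →
                  False³ φ P S I a → False³ φ P S J a
    False³-resp (atom α) {a = a} e h h′ = h (holds-cong (≈ⁱ-sym e) a α h′)
    False³-resp (¬′ φ) e h = True³-resp φ e h
    False³-resp (φ ∧′ ψ) e (inj₁ h) = inj₁ (False³-resp φ e h)
    False³-resp (φ ∧′ ψ) e (inj₂ h) = inj₂ (False³-resp ψ e h)
    False³-resp (∀′ φ) e (d , h) = d , False³-resp φ e h
    False³-resp (K t φ) {P} {S} {a = a} e = subst
      (λ d → (¬ T (agent d)) ⊎
        (Σ (T (agent d)) λ p → ∃ λ J → J ∈ worlds (S (d , p)) × False³ φ P S J a))
      (eval-cong e a t)

  DistributedTheory : Set₁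
  DistributedTheory = Agent → Pred Sentence 0ℓ

  module _ (𝒯 : DistributedTheory) where

    Dₒₚ : DPWS → DPWS
    Dₒₚ Q A .worlds I = ∀ φ → φ ∈ 𝒯 A → True φ Q I []
    Dₒₚ Q A .respects e h φ φ∈T = True-resp φ e (h φ φ∈T)

    -- A ≤ₜ-glb of truth values is 𝐟 iff one of them is.
    Dᶜ : (P S : DPWS) → DPWS
    Dᶜ P S A .worlds I = ¬ (∃ λ φ → φ ∈ 𝒯 A × False³ φ P S I [])
    Dᶜ P S A .respects e h (φ , φ∈T , f) =
      h (φ , φ∈T , False³-resp φ (≈ⁱ-sym e) f)

    -- Graph of the stable operator: Stable Q R says that R is its value at Q.
    Stable : DPWS → DPWS → Set₁
    Stable Q R = IsLeastFixpoint _≤_ (λ Q′ → Dᶜ Q′ Q) R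

    SupModel : Pred DPWS 0ℓ
    SupModel Q = IsFixpoint _≤_ Dₒₚ Q

    PStModel : Pred DBP (lsuc 0ℓ)
    PStModel B =
      Stable (liberal B) (conservative B) × Stable (conservative B) (liberal B)

    StModel : Pred DPWS (lsuc 0ℓ)
    StModel Q = PStModel (exact Q)

------------------------------------------------------------------------
-- Autoepistemic logic over Σ′

module AEL (S : Setting) where
  open Setting S

  data Fun′ : ℕ → Set where
    obj : ∀ {k} → Σₒ .Fun k → Fun′ k
    sub : ∀ {k} → Σₛ .Fun k → Fun′ (suc k)

  data Pre′ : ℕ → Set where
    obj : ∀ {k} → Σₒ .Pre k → Pre′ k
    sub : ∀ {k} → Σₛ .Pre k → Pre′ (suc k)

  Voc : Vocabulary
  Voc = record { Fun = Fun′ ; Pre = Pre′ }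

  data Formula (n : ℕ) : Set where
    atom : Atom Voc n → Formula n
    ¬′_  : Formula n → Formula n
    _∧′_ : Formula n → Formula n → Formula n
    ∀′_  : Formula (suc n) → Formula n
    K    : Formula n → Formula n

  ∃′_ : ∀ {n} → Formula (suc n) → Formula n
  ∃′ φ = ¬′ (∀′ (¬′ φ))

  Sentence : Set
  Sentence = Formula 0

  -- The additional argument of a subjective symbol is the last one.
  record Structure : Set where
    field
      interp  : Interpretation Voc D
      agreesᶠ : ∀ {k} (f : Σₒ .Fun k) ds → ⟦ interp ⟧ᶠ (obj f) ds ≡ ⟦ Iₒ ⟧ᶠ f ds
      agreesᵖ : ∀ {k} (P : Σₒ .Pre k) ds → ⟦ interp ⟧ᵖ (obj P) ds ≡ ⟦ Iₒ ⟧ᵖ P ds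
      normalᶠ : ∀ {k} (f : Σₛ .Fun k) ds d → ¬ T (agent d) →
                ⟦ interp ⟧ᶠ (sub f) (ds ∷ʳ d) ≡ δ
      normalᵖ : ∀ {k} (P : Σₛ .Pre k) ds d → ¬ T (agent d) →
                ¬ T (⟦ interp ⟧ᵖ (sub P) (ds ∷ʳ d))

  open Structure public

  _≈_ : Rel Structure 0ℓ
  I ≈ J = interp I ≈ⁱ interp J

  PWS : Set₁
  PWS = PowerSet _≈_

  record BeliefPair : Set₁ where
    field
      conservative liberal : PWS
      consistent           : conservative ≤ᴷ liberal

  open BeliefPair public

  exact : PWS → BeliefPair
  exact Q = record
    { conservative = Q ; liberal = Q ; consistent = λ J∈Q → J∈Q }

  True : ∀ {n} → Formula n → PWS → Structure → Vec D n → Set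
  True (atom α) Q I a = Holds (interp I) a α
  True (¬′ φ)   Q I a = ¬ True φ Q I a
  True (φ ∧′ ψ) Q I a = True φ Q I a × True ψ Q I a
  True (∀′ φ)   Q I a = ∀ d → True φ Q I (d ∷ a)
  True (K φ)    Q I a = ∀ J → J ∈ worlds Q → True φ Q J a

  -- As in DAEL.
  mutual
    True³ : ∀ {n} → Formula n → (P S : PWS) → Structure → Vec D n → Set
    True³ (atom α) P S I a = Holds (interp I) a α
    True³ (¬′ φ)   P S I a = False³ φ P S I a
    True³ (φ ∧′ ψ) P S I a = True³ φ P S I a × True³ ψ P S I a
    True³ (∀′ φ)   P S I a = ∀ d → True³ φ P S I (d ∷ a)
    True³ (K φ)    P S I a = ∀ J → J ∈ worlds P → True³ φ P S J a

    False³ : ∀ {n} → Formula n → (P S : PWS) → Structure → Vec D n → Set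
    False³ (atom α) P S I a = ¬ Holds (interp I) a α
    False³ (¬′ φ)   P S I a = True³ φ P S I a
    False³ (φ ∧′ ψ) P S I a = False³ φ P S I a ⊎ False³ ψ P S I a
    False³ (∀′ φ)   P S I a = ∃ λ d → False³ φ P S I (d ∷ a)
    False³ (K φ)    P S I a = ∃ λ J → J ∈ worlds S × False³ φ P S J a

  True-resp : ∀ {n} (φ : Formula n) {Q I J a} → I ≈ J →
              True φ Q I a → True φ Q J a
  True-resp (atom α) {a = a} e h = holds-cong e a α h
  True-resp (¬′ φ) e h h′ = h (True-resp φ (≈ⁱ-sym e) h′)
  True-resp (φ ∧′ ψ) e (h , h′) = True-resp φ e h , True-resp ψ e h′
  True-resp (∀′ φ) e h d = True-resp φ e (h d)
  True-resp (K φ) e h = h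

  mutual
    True³-resp : ∀ {n} (φ : Formula n) {P S I J a} → I ≈ J →
                 True³ φ P S I a → True³ φ P S J a
    True³-resp (atom α) {a = a} e h = holds-cong e a α h
    True³-resp (¬′ φ) e h = False³-resp φ e h
    True³-resp (φ ∧′ ψ) e (h , h′) = True³-resp φ e h , True³-resp ψ e h′
    True³-resp (∀′ φ) e h d = True³-resp φ e (h d)
    True³-resp (K φ) e h = h

    False³-resp : ∀ {n} (φ : Formula n) {P S I J a} → I ≈ J →
                  False³ φ P S I a → False³ φ P S J a
    False³-resp (atom α) {a = a} e h h′ = h (holds-cong (≈ⁱ-sym e) a α h′)
    False³-resp (¬′ φ) e h = True³-resp φ e h
    False³-resp (φ ∧′ ψ) e (inj₁ h) = inj₁ (False³-resp φ e h)
    False³-resp (φ ∧′ ψ) e (inj₂ h) = inj₂ (False³-resp ψ e h)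
    False³-resp (∀′ φ) e (d , h) = d , False³-resp φ e h
    False³-resp (K φ) e h = h

  Theory : Set₁
  Theory = Pred Sentence 0ℓ

  module _ (𝒯 : Theory) where

    Dₒₚ : PWS → PWS
    Dₒₚ Q .worlds J = ∀ φ → φ ∈ 𝒯 → True φ Q J []
    Dₒₚ Q .respects e h φ φ∈T = True-resp φ e (h φ φ∈T)

    Dᶜ : (P S : PWS) → PWS
    Dᶜ P S .worlds J = ¬ (∃ λ φ → φ ∈ 𝒯 × False³ φ P S J [])
    Dᶜ P S .respects e h (φ , φ∈T , f) =
      h (φ , φ∈T , False³-resp φ (≈ⁱ-sym e) f)

    Stable : PWS → PWS → Set₁
    Stable Q R = IsLeastFixpoint _≤ᴷ_ (λ Q′ → Dᶜ Q′ Q) R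

    SupModel : Pred PWS 0ℓ
    SupModel Q = IsFixpoint _≤ᴷ_ Dₒₚ Q

    PStModel : Pred BeliefPair (lsuc 0ℓ)
    PStModel B =
      Stable (liberal B) (conservative B) × Stable (conservative B) (liberal B)

    StModel : Pred PWS (lsuc 0ℓ)
    StModel Q = PStModel (exact Q)

------------------------------------------------------------------------
-- The translation from dAEL to AEL

module Translation (S : Setting) where
  open Setting S
  private
    module L = DAEL S
    module M = AEL S

  open M using (obj; sub)

  mutual
    τ-term : ∀ {n} → Term M.Voc n → Term L.Voc n → Term M.Voc n
    τ-term s (var x)           = var x
    τ-term s (fun (inj₁ f) ts) = fun (obj f) (τ-terms s ts)
    τ-term s (fun (inj₂ f) ts) = fun (sub f) (τ-terms s ts ∷ʳ s)

    τ-terms : ∀ {n k} → Term M.Voc n → Vec (Term L.Voc n) k → Vec (Term M.Voc n) k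
    τ-terms s []       = []
    τ-terms s (t ∷ ts) = τ-term s t ∷ τ-terms s ts

  τ-atom : ∀ {n} → Term M.Voc n → Atom L.Voc n → Atom M.Voc n
  τ-atom s (pre (inj₁ P) ts) = pre (obj P) (τ-terms s ts)
  τ-atom s (pre (inj₂ P) ts) = pre (sub P) (τ-terms s ts ∷ʳ s)
  τ-atom s (t ≐ u)           = τ-term s t ≐ τ-term s u

  renameAtom : ∀ {V m n} → (Fin m → Fin n) → Atom V m → Atom V n
  renameAtom ρ (pre P ts) = pre P (renames ρ ts)
  renameAtom ρ (s ≐ t)    = rename ρ s ≐ rename ρ t

  -- τ-renamed ρ s φ translates φ with its variables renamed along ρ.  The
  -- fresh variable x introduced for K is the new index zero, so it is the
  -- variables of φ that are shifted to make room for it.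
  τ-renamed : ∀ {m n} → (Fin m → Fin n) → Term M.Voc n → L.Formula m → M.Formula n
  τ-renamed ρ s (L.atom α) = M.atom (τ-atom s (renameAtom ρ α))
  τ-renamed ρ s (L.¬′ φ)   = M.¬′ τ-renamed ρ s φ
  τ-renamed ρ s (φ L.∧′ ψ) = τ-renamed ρ s φ M.∧′ τ-renamed ρ s ψ
  τ-renamed ρ s (L.∀′ φ)   = M.∀′ τ-renamed (lift 1 ρ) (rename suc s) φ
  τ-renamed ρ s (L.K t φ)  = M.∃′
    (M.atom (x ≐ rename suc (τ-term s (rename ρ t))) M.∧′
    (M.atom (pre (obj Apred) [ x ]) M.∧′
     M.K (τ-renamed (suc ∘ ρ) x φ)))
    where
    x = var zero

  τ-formula : ∀ {n} → Term M.Voc n → L.Formula n → M.Formula n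
  τ-formula = τ-renamed (λ x → x)

  τ-theory : L.DistributedTheory → M.Theory
  τ-theory 𝒯 ψ = ∃ λ A → ∃ λ φ →
    φ ∈ 𝒯 A × ψ ≡ τ-formula (fun (obj (name A)) []) φ

  ifAgent : ∀ {X : Set} → D → (Agent → X) → X → X
  ifAgent d x y with T? (agent d)
  ... | yes p = x (d , p)
  ... | no  _ = y

  ifAgent-no : ∀ {X : Set} {d} {x : Agent → X} {y} → ¬ T (agent d) →
               ifAgent d x y ≡ y
  ifAgent-no {d = d} ¬p with T? (agent d)
  ... | yes p = contradiction p ¬p
  ... | no  _ = refl

  τ-interp : (Agent → L.Structure) → Interpretation M.Voc D
  ⟦ τ-interp I ⟧ᶠ (obj f) ds = ⟦ Iₒ ⟧ᶠ f ds
  ⟦ τ-interp I ⟧ᶠ (sub f) ds =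
    ifAgent (last ds) (λ A → ⟦ L.interp (I A) ⟧ᶠ (inj₂ f) (init ds)) δ
  ⟦ τ-interp I ⟧ᵖ (obj P) ds = ⟦ Iₒ ⟧ᵖ P ds
  ⟦ τ-interp I ⟧ᵖ (sub P) ds =
    ifAgent (last ds) (λ A → ⟦ L.interp (I A) ⟧ᵖ (inj₂ P) (init ds)) false

  τ-structure : (Agent → L.Structure) → M.Structure
  τ-structure I = record
    { interp  = τ-interp I
    ; agreesᶠ = λ _ _ → refl
    ; agreesᵖ = λ _ _ → refl
    ; normalᶠ = λ f ds d ¬p → ifAgent-no (¬p ∘ subst (T ∘ agent) (last-∷ʳ d ds))
    ; normalᵖ = λ P ds d ¬p →
        subst T (ifAgent-no (¬p ∘ subst (T ∘ agent) (last-∷ʳ d ds)))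
    }

  τ-pws : L.DPWS → M.PWS
  τ-pws Q .worlds J =
    ∃ λ I → (∀ A → I A ∈ worlds (Q A)) × J M.≈ τ-structure I
  τ-pws Q .respects e (I , I∈Q , e′) = I , I∈Q , ≈ⁱ-trans (≈ⁱ-sym e) e′

  τ-beliefpair : L.DBP → M.BeliefPair
  τ-beliefpair B = record
    { conservative = τ-pws (L.conservative B)
    ; liberal      = τ-pws (L.liberal B)
    ; consistent   = λ (I , I∈ , e) → I , (λ A → L.consistent B A (I∈ A)) , e
    }

{-# OPTIONS --safe #-}

-- Let the slice of a Σ′-structure J at an agent A be the Σ-structure obtained
-- by fixing the last argument of the subjective symbols to A.  If the dAEL
-- pair (P′ , S′) consists of the slices of the AEL pair (P , S), then φ has at
-- the slice of J at A the value that τ(A , φ) has at J; no universal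
-- consistency is needed for this.  As Σ′-structures are determined by their
-- slices, the AEL operators map P to τ_pws of the value of the dAEL operators
-- at P′.  The slices of τ_pws(Q) are Q itself when Q is universally consistent,
-- and then fixpoints can be compared along τ_pws.
--
-- Least fixpoints require some care with degenerate sets.  An AEL fixpoint is
-- empty or is τ_pws of its slices.  On the dAEL side, a fixpoint with some but
-- not all components empty has no AEL counterpart, so instead of it one uses
-- the least fixpoint given by Knaster–Tarski: it lies below the universally
-- consistent one at hand, hence is universally consistent itself.

module Submission where

open import Defs
open import Level using (lift; lower; 0ℓ) renaming (suc to lsuc)
open import Axiom.ExcludedMiddle using (ExcludedMiddle)
open import Data.Bool.Base using (T; true; false)
open import Data.Bool.Properties using (T?; T-irrelevant)
open import Data.Empty using (⊥-elim)
open import Data.Fin.Base as Fin using (Fin; zero; suc)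
open import Data.Nat.Base using (ℕ; suc)
open import Data.Product.Base using (∃; _×_; _,_; proj₁; proj₂)
open import Data.Product.Function.NonDependent.Propositional using (_×-⇔_)
open import Data.Sum.Base using (inj₁; inj₂)
open import Data.Sum.Function.Propositional using (_⊎-⇔_)
open import Data.Vec.Base using (Vec; []; _∷_; lookup; init; last; _∷ʳ_; initLast)
open import Data.Vec.Properties using (init-∷ʳ; last-∷ʳ)
open import Function.Base using (_∘_)
open import Function.Bundles using (_⇔_; mk⇔; Equivalence)
open import Function.Related.TypeIsomorphisms using (¬-cong-⇔)
open import Relation.Nullary.Negation.Core using (¬_)
open import Relation.Nullary.Decidable.Core as Dec
  using (yes; no; toWitness; fromWitness; decidable-stable)
open import Relation.Unary using (_∈_)
open import Relation.Binary.PropositionalEquality.Core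
  using (_≡_; refl; sym; trans; cong; cong₂; subst)

open Equivalence using (to; from)
open Interpretation

-- Evaluation of extended argument lists and weakened terms

module _ {V : Vocabulary} {D : Set} (I : Interpretation V D) where

  module _ {n : ℕ} (a : Vec D n) where

    evals-∷ʳ : ∀ {k} (ts : Vec (Term V n) k) t →
               evals I a (ts ∷ʳ t) ≡ evals I a ts ∷ʳ eval I a t
    evals-∷ʳ []       t = refl
    evals-∷ʳ (u ∷ ts) t = cong (_ ∷_) (evals-∷ʳ ts t)

  module _ {n : ℕ} (d : D) (a : Vec D n) where
    mutual
      eval-weaken : ∀ t → eval I (d ∷ a) (rename suc t) ≡ eval I a t
      eval-weaken (var x)    = refl
      eval-weaken (fun f ts) = cong (⟦ I ⟧ᶠ f) (evals-weaken ts)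

      evals-weaken : ∀ {k} (ts : Vec (Term V n) k) →
                     evals I (d ∷ a) (renames suc ts) ≡ evals I a ts
      evals-weaken []       = refl
      evals-weaken (t ∷ ts) = cong₂ _∷_ (eval-weaken t) (evals-weaken ts)

module _ (S : Setting) where
  open Setting S
  open Translation S
  private
    module L = DAEL S
    module M = AEL S

  -- Slices

  slice : Agent → M.Structure → L.Structure
  ⟦ L.interp (slice A J) ⟧ᶠ (inj₁ f) ds = ⟦ M.interp J ⟧ᶠ (M.obj f) ds
  ⟦ L.interp (slice A J) ⟧ᶠ (inj₂ f) ds = ⟦ M.interp J ⟧ᶠ (M.sub f) (ds ∷ʳ proj₁ A)
  ⟦ L.interp (slice A J) ⟧ᵖ (inj₁ P) ds = ⟦ M.interp J ⟧ᵖ (M.obj P) ds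
  ⟦ L.interp (slice A J) ⟧ᵖ (inj₂ P) ds = ⟦ M.interp J ⟧ᵖ (M.sub P) (ds ∷ʳ proj₁ A)
  L.agreesᶠ (slice A J) = M.agreesᶠ J
  L.agreesᵖ (slice A J) = M.agreesᵖ J

  slice-cong : ∀ A {J J′} → J M.≈ J′ → slice A J L.≈ slice A J′
  slice-cong A e .fun≈ (inj₁ f) ds = e .fun≈ (M.obj f) ds
  slice-cong A e .fun≈ (inj₂ f) ds = e .fun≈ (M.sub f) _
  slice-cong A e .pre≈ (inj₁ P) ds = e .pre≈ (M.obj P) ds
  slice-cong A e .pre≈ (inj₂ P) ds = e .pre≈ (M.sub P) _

  ifAgent-yes : ∀ {X : Set} (A : Agent) {x : Agent → X} {y} →
                ifAgent (proj₁ A) x y ≡ x A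
  ifAgent-yes (d , p) {x} with T? (agent d)
  ... | yes q = cong (λ r → x (d , r)) (T-irrelevant q p)
  ... | no ¬p = ⊥-elim (¬p p)

  ifAgent-∷ʳ : ∀ {X : Set} {k} (A : Agent) (ds : Vec D k) (x : Agent → Vec D k → X) y →
               ifAgent (last (ds ∷ʳ proj₁ A)) (λ B → x B (init (ds ∷ʳ proj₁ A))) y ≡ x A ds
  ifAgent-∷ʳ A ds x y = trans
    (cong₂ (λ d es → ifAgent d (λ B → x B es) y) (last-∷ʳ (proj₁ A) ds) (init-∷ʳ (proj₁ A) ds))
    (ifAgent-yes A)

  -- Every nonempty vector is its `init` followed by its `last`, and normality prescribes the value
  -- when the `last` is no agent. Hence the values at agents determine a subjective symbol.
  ifAgent-init-last : ∀ {X : Set} {k} (x : Vec D (suc k) → X) {y} →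
    (∀ ds d → ¬ T (agent d) → x (ds ∷ʳ d) ≡ y) →
    ∀ ds → x ds ≡ ifAgent (last ds) (λ A → x (init ds ∷ʳ proj₁ A)) y
  ifAgent-init-last x normal ds with T? (agent (last ds))
  ... | yes p = cong x (proj₂ (proj₂ (initLast ds)))
  ... | no ¬p = trans (cong x (proj₂ (proj₂ (initLast ds)))) (normal (init ds) (last ds) ¬p)

  slice-τ-structure : ∀ A I → slice A (τ-structure I) L.≈ I A
  slice-τ-structure A I .fun≈ (inj₁ f) ds = sym (L.agreesᶠ (I A) f ds)
  slice-τ-structure A I .fun≈ (inj₂ f) ds =
    ifAgent-∷ʳ A ds (λ B → ⟦ L.interp (I B) ⟧ᶠ (inj₂ f)) δ
  slice-τ-structure A I .pre≈ (inj₁ P) ds = sym (L.agreesᵖ (I A) P ds)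
  slice-τ-structure A I .pre≈ (inj₂ P) ds =
    ifAgent-∷ʳ A ds (λ B → ⟦ L.interp (I B) ⟧ᵖ (inj₂ P)) false

  ≈-τ-structure-slices : ∀ J → J M.≈ τ-structure (λ A → slice A J)
  ≈-τ-structure-slices J .fun≈ (M.obj f) ds = M.agreesᶠ J f ds
  ≈-τ-structure-slices J .fun≈ (M.sub f) ds =
    ifAgent-init-last (⟦ M.interp J ⟧ᶠ (M.sub f)) (M.normalᶠ J f) ds
  ≈-τ-structure-slices J .pre≈ (M.obj P) ds = M.agreesᵖ J P ds
  ≈-τ-structure-slices J .pre≈ (M.sub P) ds =
    ifAgent-init-last (⟦ M.interp J ⟧ᵖ (M.sub P)) (λ es d ¬p → ¬T⇒≡false (M.normalᵖ J P es d ¬p)) ds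
    where
    ¬T⇒≡false : ∀ {b} → ¬ T b → b ≡ false
    ¬T⇒≡false {false} _  = refl
    ¬T⇒≡false {true} ¬t = ⊥-elim (¬t _)

  -- The family behind a member of `τ-pws Q` can only be its own slices, up to `≈`, since slicing
  -- and `τ-structure` undo each other.
  ∈-τ-pws : ∀ Q J → J ∈ worlds (τ-pws Q) ⇔ (∀ A → slice A J ∈ worlds (Q A))
  ∈-τ-pws Q J = mk⇔
    (λ (I , I∈Q , J≈) A → Q A .respects
      (≈ⁱ-sym (≈ⁱ-trans (slice-cong A J≈) (slice-τ-structure A I))) (I∈Q A))
    (λ slices → _ , slices , ≈-τ-structure-slices J)

  τ-pws-mono : ∀ Q R → Q L.≤ R → τ-pws Q ≤ᴷ τ-pws R
  τ-pws-mono Q R Q≤R (I , I∈R , J≈) = I , (λ A → Q≤R A (I∈R A)) , J≈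

  -- A relation instead of a function, so that one invariance proof serves both `projection P` and a
  -- universally consistent `Q` seen as the slices of `τ-pws Q`.
  record IsProjection (P : M.PWS) (Q : L.DPWS) : Set where
    field
      slice-∈ : ∀ A {J} → J ∈ worlds P → slice A J ∈ worlds (Q A)
      unslice : ∀ A {I} → I ∈ worlds (Q A) → ∃ λ J → J ∈ worlds P × slice A J L.≈ I

  open IsProjection

  projection : M.PWS → L.DPWS
  projection P A .worlds I = ∃ λ J → J ∈ worlds P × slice A J L.≈ I
  projection P A .respects e (J , J∈P , ≈I) = J , J∈P , ≈ⁱ-trans ≈I e

  projection-isProjection : ∀ P → IsProjection P (projection P)
  projection-isProjection P .slice-∈ A {J} J∈P =
    J , J∈P , record { fun≈ = λ _ _ → refl ; pre≈ = λ _ _ → refl }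
  projection-isProjection P .unslice A I∈ = I∈

  -- Invariance of truth values

  -- The situation in which φ, at the slice of J at A under a, is to have the value
  -- of τ-renamed ρ s φ at J under b.
  record Match (A : Agent) (J : M.Structure) {m n} (a : Vec D m) (b : Vec D n)
               (ρ : Fin m → Fin n) (s : Term M.Voc n) : Set where
    field
      agent-eval  : eval (M.interp J) b s ≡ proj₁ A
      assignments : ∀ x → lookup a x ≡ lookup b (ρ x)

  open Match

  module _ {A J m n} {a : Vec D m} {b : Vec D n} {ρ : Fin m → Fin n} {s : Term M.Voc n}
           (match : Match A J a b ρ s) where
    mutual
      eval-τ : ∀ t → eval (L.interp (slice A J)) a t ≡
                     eval (M.interp J) b (τ-term s (rename ρ t))
      eval-τ (var x)           = assignments match x
      eval-τ (fun (inj₁ f) ts) = cong (⟦ M.interp J ⟧ᶠ (M.obj f)) (evals-τ ts)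
      eval-τ (fun (inj₂ f) ts) = cong (⟦ M.interp J ⟧ᶠ (M.sub f)) (evals-τ-∷ʳ ts)

      evals-τ : ∀ {k} (ts : Vec (Term L.Voc m) k) →
                evals (L.interp (slice A J)) a ts ≡
                evals (M.interp J) b (τ-terms s (renames ρ ts))
      evals-τ []       = refl
      evals-τ (t ∷ ts) = cong₂ _∷_ (eval-τ t) (evals-τ ts)

      evals-τ-∷ʳ : ∀ {k} (ts : Vec (Term L.Voc m) k) →
                   evals (L.interp (slice A J)) a ts ∷ʳ proj₁ A ≡
                   evals (M.interp J) b (τ-terms s (renames ρ ts) ∷ʳ s)
      evals-τ-∷ʳ ts = trans (cong₂ _∷ʳ_ (evals-τ ts) (sym (agent-eval match)))
                            (sym (evals-∷ʳ (M.interp J) b (τ-terms s (renames ρ ts)) s))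

    holds-τ : ∀ α → Holds (L.interp (slice A J)) a α ≡
                    Holds (M.interp J) b (τ-atom s (renameAtom ρ α))
    holds-τ (pre (inj₁ P) ts) = cong (T ∘ ⟦ M.interp J ⟧ᵖ (M.obj P)) (evals-τ ts)
    holds-τ (pre (inj₂ P) ts) = cong (T ∘ ⟦ M.interp J ⟧ᵖ (M.sub P)) (evals-τ-∷ʳ ts)
    holds-τ (t ≐ u)           = cong₂ _≡_ (eval-τ t) (eval-τ u)

    holds-τ-⇔ : ∀ α → Holds (L.interp (slice A J)) a α ⇔
                      Holds (M.interp J) b (τ-atom s (renameAtom ρ α))
    holds-τ-⇔ α = mk⇔ (subst (λ X → X) (holds-τ α)) (subst (λ X → X) (sym (holds-τ α)))

    eval-τ-weaken : ∀ t d → eval (L.interp (slice A J)) a t ≡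
                    eval (M.interp J) (d ∷ b) (rename suc (τ-term s (rename ρ t)))
    eval-τ-weaken t d =
      trans (eval-τ t) (sym (eval-weaken (M.interp J) d b (τ-term s (rename ρ t))))

    match-∀ : ∀ d → Match A J (d ∷ a) (d ∷ b) (Fin.lift 1 ρ) (rename suc s)
    match-∀ d .agent-eval          = trans (eval-weaken (M.interp J) d b s) (agent-eval match)
    match-∀ d .assignments zero    = refl
    match-∀ d .assignments (suc x) = assignments match x

    -- The agent term becomes the fresh variable, whose value is the same in every structure, so the
    -- match persists at any world `J′`.
    match-K : ∀ B J′ → Match B J′ a (proj₁ B ∷ b) (suc ∘ ρ) (var zero)
    match-K B J′ .agent-eval  = refl
    match-K B J′ .assignments = assignments match

  match-name : ∀ A J → Match A J [] [] (λ x → x) (fun (M.obj (name A)) [])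
  match-name A J .agent-eval = trans (M.agreesᶠ J (name A) []) (name-correct A)
  match-name A J .assignments ()

  Apred-agent : ∀ J {d} → T (⟦ M.interp J ⟧ᵖ (M.obj Apred) (d ∷ [])) ⇔ T (agent d)
  Apred-agent J {d} = mk⇔ (subst T eq) (subst T (sym eq))
    where eq = trans (M.agreesᵖ J Apred (d ∷ [])) (Apred-correct d)

  -- Monotonicity in the knowledge order

  UniversallyConsistent-≤ : ∀ Q R → Q L.≤ R →
    L.UniversallyConsistent R → L.UniversallyConsistent Q
  UniversallyConsistent-≤ Q R Q≤R uc A = let I , I∈R = uc A in I , Q≤R A I∈R

  mutual
    -- Truth of `K` quantifies universally over `P′`, which has fewer worlds than `P`, while falsity
    -- of `K` looks for its world in the fixed `R`. Negation swaps the two, hence the joint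
    -- induction.
    True³-mono : ∀ {n} (φ : L.Formula n) {P P′ R I a} → P L.≤ P′ →
                 L.True³ φ P R I a → L.True³ φ P′ R I a
    True³-mono (L.atom α) le h        = h
    True³-mono (L.¬′ φ)   le h        = False³-mono φ le h
    True³-mono (φ L.∧′ ψ) le (h , h′) = True³-mono φ le h , True³-mono ψ le h′
    True³-mono (L.∀′ φ)   le h d      = True³-mono φ le (h d)
    True³-mono (L.K t φ)  le (p , h)  = p , λ J J∈P′ → True³-mono φ le (h J (le _ J∈P′))

    False³-mono : ∀ {n} (φ : L.Formula n) {P P′ R I a} → P L.≤ P′ →
                  L.False³ φ P R I a → L.False³ φ P′ R I a
    False³-mono (L.atom α) le h        = h
    False³-mono (L.¬′ φ)   le h        = True³-mono φ le h
    False³-mono (φ L.∧′ ψ) le (inj₁ h) = inj₁ (False³-mono φ le h)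
    False³-mono (φ L.∧′ ψ) le (inj₂ h) = inj₂ (False³-mono ψ le h)
    False³-mono (L.∀′ φ)   le (d , h)  = d , False³-mono φ le h
    False³-mono (L.K t φ)  le (inj₁ ¬p) = inj₁ ¬p
    False³-mono (L.K t φ)  le (inj₂ (p , J , J∈R , h)) =
      inj₂ (p , J , J∈R , False³-mono φ le h)

  Dᶜ-monoˡ : ∀ 𝒯 P P′ R → P L.≤ P′ → L.Dᶜ 𝒯 P R L.≤ L.Dᶜ 𝒯 P′ R
  Dᶜ-monoˡ 𝒯 P P′ R le A h (φ , φ∈𝒯 , f) = h (φ , φ∈𝒯 , False³-mono φ le f)

  module _ (em : ExcludedMiddle (lsuc 0ℓ)) where

    em₀ : ExcludedMiddle 0ℓ
    em₀ {P} = Dec.map′ lower (lift {ℓ = lsuc 0ℓ}) em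

    module _ {P Q} (pr : IsProjection P Q) where

      True-τ : ∀ {m n} (φ : L.Formula m) {ρ : Fin m → Fin n} {s A J a b} →
               Match A J a b ρ s →
               L.True φ Q (slice A J) a ⇔ M.True (τ-renamed ρ s φ) P J b
      True-τ (L.atom α) c = holds-τ-⇔ c α
      True-τ (L.¬′ φ)   c = ¬-cong-⇔ (True-τ φ c)
      True-τ (φ L.∧′ ψ) c = True-τ φ c ×-⇔ True-τ ψ c
      True-τ (L.∀′ φ) c = mk⇔
        (λ h d → to (True-τ φ (match-∀ c d)) (h d))
        (λ h d → from (True-τ φ (match-∀ c d)) (h d))
      True-τ (L.K t φ) {ρ} {s} {A} {J} {a} {b} c = mk⇔
        (λ (p , h) ¬h → ¬h _
          ( eval-τ-weaken c t _
          , from (Apred-agent J) p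
          , λ J′ J′∈P → to (True-τ φ (match-K c _ _)) (h _ (slice-∈ pr _ J′∈P))))
        -- `∃′` abbreviates `¬′ ∀′ ¬′`, so two-valued truth supplies a witness only under double
        -- negation.
        (λ ¬¬h → decidable-stable em₀ (λ ¬h → ¬¬h (λ d h → ¬h (fromExists d h))))
        where
        fromExists : ∀ d → _ → L.True (L.K t φ) Q (slice A J) a
        fromExists d (d≡ , ap , h) with refl ← trans d≡ (sym (eval-τ-weaken c t d)) =
          to (Apred-agent J) ap ,
          λ I I∈Q → let J′ , J′∈P , J′≈ = unslice pr _ I∈Q in
            L.True-resp φ J′≈ (from (True-τ φ (match-K c _ _)) (h J′ J′∈P))

    module _ {P P′ R R′} (prP : IsProjection P P′) (prR : IsProjection R R′) where
      mutual
        True³-τ : ∀ {m n} (φ : L.Formula m) {ρ : Fin m → Fin n} {s A J a b} →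
                  Match A J a b ρ s →
                  L.True³ φ P′ R′ (slice A J) a ⇔ M.True³ (τ-renamed ρ s φ) P R J b
        True³-τ (L.atom α) c = holds-τ-⇔ c α
        True³-τ (L.¬′ φ)   c = False³-τ φ c
        True³-τ (φ L.∧′ ψ) c = True³-τ φ c ×-⇔ True³-τ ψ c
        True³-τ (L.∀′ φ) c = mk⇔
          (λ h d → to (True³-τ φ (match-∀ c d)) (h d))
          (λ h d → from (True³-τ φ (match-∀ c d)) (h d))
        True³-τ (L.K t φ) {ρ} {s} {A} {J} {a} {b} c = mk⇔
          (λ (p , h) → _
            , eval-τ-weaken c t _
            , from (Apred-agent J) p
            , λ J′ J′∈P → to (True³-τ φ (match-K c _ _)) (h _ (slice-∈ prP _ J′∈P)))
          (λ (d , h) → fromExists d h)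
          where
          fromExists : ∀ d → _ → L.True³ (L.K t φ) P′ R′ (slice A J) a
          fromExists d (d≡ , ap , h) with refl ← trans d≡ (sym (eval-τ-weaken c t d)) =
            to (Apred-agent J) ap ,
            λ I I∈P → let J′ , J′∈P , J′≈ = unslice prP _ I∈P in
              L.True³-resp φ J′≈ (from (True³-τ φ (match-K c _ _)) (h J′ J′∈P))

        False³-τ : ∀ {m n} (φ : L.Formula m) {ρ : Fin m → Fin n} {s A J a b} →
                   Match A J a b ρ s →
                   L.False³ φ P′ R′ (slice A J) a ⇔ M.False³ (τ-renamed ρ s φ) P R J b
        False³-τ (L.atom α) c = ¬-cong-⇔ (holds-τ-⇔ c α)
        False³-τ (L.¬′ φ)   c = True³-τ φ c
        False³-τ (φ L.∧′ ψ) c = False³-τ φ c ⊎-⇔ False³-τ ψ c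
        False³-τ (L.∀′ φ) c = mk⇔
          (λ (d , h) → d , to (False³-τ φ (match-∀ c d)) h)
          (λ (d , h) → d , from (False³-τ φ (match-∀ c d)) h)
        False³-τ (L.K t φ) {ρ} {s} {A} {J} {a} {b} c = mk⇔ toAll fromAll
          where
          toAll : L.False³ (L.K t φ) P′ R′ (slice A J) a →
                  M.False³ (τ-renamed ρ s (L.K t φ)) P R J b
          -- An existential is false when each instance is; away from the value of `t` the equation
          -- in the conjunction already fails.
          toAll h d with em₀ {d ≡ eval (M.interp J) (d ∷ b) (rename suc (τ-term s (rename ρ t)))}
          ... | no d≢  = inj₁ d≢
          ... | yes d≡ with refl ← trans d≡ (sym (eval-τ-weaken c t d)) with h
          ...   | inj₁ ¬p = inj₂ (inj₁ (¬p ∘ to (Apred-agent J)))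
          ...   | inj₂ (p , I , I∈R , h′) = let J′ , J′∈R , J′≈ = unslice prR _ I∈R in
            inj₂ (inj₂ (J′ , J′∈R ,
              to (False³-τ φ (match-K c _ _)) (L.False³-resp φ (≈ⁱ-sym J′≈) h′)))

          fromAll : M.False³ (τ-renamed ρ s (L.K t φ)) P R J b →
                    L.False³ (L.K t φ) P′ R′ (slice A J) a
          fromAll h with h (eval (L.interp (slice A J)) a t)
          ... | inj₁ d≢        = ⊥-elim (d≢ (eval-τ-weaken c t _))
          ... | inj₂ (inj₁ ¬ap) = inj₁ (¬ap ∘ from (Apred-agent J))
          -- The falsifying world does not tell whether `t` denotes an agent. If not, `K t φ` is
          -- false outright; otherwise the world is sliced at that agent.
          ... | inj₂ (inj₂ (J′ , J′∈R , h′)) with T? (agent (eval (L.interp (slice A J)) a t))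
          ...   | no ¬p = inj₁ ¬p
          ...   | yes p = inj₂ (p , _ , slice-∈ prR _ J′∈R , from (False³-τ φ (match-K c _ _)) h′)

    -- `τ-theory` pools the sentences of all agents, but those of `A` constrain only the slice at
    -- `A`, so the condition on `J` splits into one condition per slice.
    Dₒₚ-τ : ∀ 𝒯 {P Q} → IsProjection P Q → ∀ J →
            J ∈ worlds (M.Dₒₚ (τ-theory 𝒯) P) ⇔ J ∈ worlds (τ-pws (L.Dₒₚ 𝒯 Q))
    Dₒₚ-τ 𝒯 {Q = Q} pr J = mk⇔
      (λ h → from (∈-τ-pws (L.Dₒₚ 𝒯 Q) J) λ A φ φ∈𝒯 →
        from (True-τ pr φ (match-name A J)) (h _ (A , φ , φ∈𝒯 , refl)))
      (λ { h _ (A , φ , φ∈𝒯 , refl) →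
        to (True-τ pr φ (match-name A J)) (to (∈-τ-pws (L.Dₒₚ 𝒯 Q) J) h A φ φ∈𝒯) })

    Dᶜ-τ : ∀ 𝒯 {P P′ R R′} → IsProjection P P′ → IsProjection R R′ → ∀ J →
           J ∈ worlds (M.Dᶜ (τ-theory 𝒯) P R) ⇔ J ∈ worlds (τ-pws (L.Dᶜ 𝒯 P′ R′))
    Dᶜ-τ 𝒯 {P′ = P′} {R′ = R′} prP prR J = mk⇔
      (λ h → from (∈-τ-pws (L.Dᶜ 𝒯 P′ R′) J) λ A (φ , φ∈𝒯 , f) →
        h (_ , (A , φ , φ∈𝒯 , refl) , to (False³-τ prP prR φ (match-name A J)) f))
      (λ { h (_ , (A , φ , φ∈𝒯 , refl) , f) →
        to (∈-τ-pws (L.Dᶜ 𝒯 P′ R′) J) h A (φ , φ∈𝒯 , from (False³-τ prP prR φ (match-name A J)) f) })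

    -- Universally consistent families

    extend-to-family : ∀ Q → L.UniversallyConsistent Q → ∀ {A I} → I ∈ worlds (Q A) →
      ∃ λ F → (∀ B → F B ∈ worlds (Q B)) × F A ≡ I
    extend-to-family Q uc {A} {I} I∈Q = (λ B → proj₁ (choice B)) , (λ B → proj₂ (choice B)) , at-A
      where
      choice : ∀ B → ∃ λ J → J ∈ worlds (Q B)
      choice B with em₀ {A ≡ B}
      ... | yes refl = I , I∈Q
      ... | no _     = uc B

      at-A : proj₁ (choice A) ≡ I
      at-A with em₀ {A ≡ A}
      ... | yes refl = refl
      ... | no A≢A   = ⊥-elim (A≢A refl)

    -- A world of one agent is a slice of a combined structure only if every other agent can
    -- contribute a world; universal consistency supplies these.
    τ-pws-isProjection : ∀ Q → L.UniversallyConsistent Q → IsProjection (τ-pws Q) Q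
    τ-pws-isProjection Q uc .slice-∈ A {J} J∈τQ = to (∈-τ-pws Q J) J∈τQ A
    τ-pws-isProjection Q uc .unslice A I∈Q with extend-to-family Q uc I∈Q
    ... | F , F∈Q , refl =
      τ-structure F ,
      (F , F∈Q , record { fun≈ = λ _ _ → refl ; pre≈ = λ _ _ → refl }) ,
      slice-τ-structure A F

    -- Every world of `R` is a slice of a member of `τ-pws R`, which then belongs to `τ-pws Q` and
    -- so has its slices in `Q`.
    τ-pws-reflects-≤ : ∀ Q R → L.UniversallyConsistent R →
                       τ-pws Q ≤ᴷ τ-pws R → Q L.≤ R
    τ-pws-reflects-≤ Q R uc τQ≤τR A I∈R =
      let J , J∈τR , J≈I = τ-pws-isProjection R uc .unslice A I∈R
      in Q A .respects J≈I (to (∈-τ-pws Q J) (τQ≤τR {J} J∈τR) A)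

    -- Comparison of fixpoints

    -- As `≤` reverses inclusion, the infimum of all pre-fixpoints is their componentwise union.
    module KnasterTarski (F : L.DPWS → L.DPWS)
                         (mono : ∀ Q R → Q L.≤ R → F Q L.≤ F R) where

      -- Excluded middle is used to bring the quantification over all Q down to Set.
      lfp : L.DPWS
      lfp A .worlds I = Dec.True (em {∃ λ Q → F Q L.≤ Q × I ∈ worlds (Q A)})
      lfp A .respects e h =
        let Q , FQ≤Q , I∈Q = toWitness h in fromWitness (Q , FQ≤Q , Q A .respects e I∈Q)

      lfp-least : ∀ Q → F Q L.≤ Q → lfp L.≤ Q
      lfp-least Q FQ≤Q A I∈Q = fromWitness (Q , FQ≤Q , I∈Q)

      lfp-isFixpoint : IsFixpoint L._≤_ F lfp
      lfp-isFixpoint = F-lfp≤lfp , lfp-least (F lfp) (mono (F lfp) lfp F-lfp≤lfp)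
        where
        F-lfp≤lfp : F lfp L.≤ lfp
        F-lfp≤lfp A h =
          let Q , FQ≤Q , I∈Q = toWitness h in mono lfp Q (lfp-least Q FQ≤Q) A (FQ≤Q A I∈Q)

    -- Covers both `Dₒₚ` and `Dᶜ` with its liberal argument held fixed.
    module Transfer
      (F : L.DPWS → L.DPWS) (G : M.PWS → M.PWS)
      (G-τ : ∀ {P Q} → IsProjection P Q → ∀ J → J ∈ worlds (G P) ⇔ J ∈ worlds (τ-pws (F Q)))
      where

      isFixpoint-τ : ∀ Q → L.UniversallyConsistent Q →
                     IsFixpoint L._≤_ F Q ⇔ IsFixpoint _≤ᴷ_ G (τ-pws Q)
      isFixpoint-τ Q uc = mk⇔
        (λ (FQ≤Q , Q≤FQ) →
          (λ {J} J∈ → from (G-τQ J) (τ-pws-mono (F Q) Q FQ≤Q {J} J∈)) ,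
          (λ {J} J∈ → τ-pws-mono Q (F Q) Q≤FQ {J} (to (G-τQ J) J∈)))
        (λ (GτQ≤τQ , τQ≤GτQ) →
          -- This inequality makes `F Q` universally consistent, as reflecting the converse one
          -- requires.
          let FQ≤Q = τ-pws-reflects-≤ (F Q) Q uc (λ {J} J∈ → to (G-τQ J) (GτQ≤τQ {J} J∈))
          in FQ≤Q , τ-pws-reflects-≤ Q (F Q) (UniversallyConsistent-≤ (F Q) Q FQ≤Q uc)
                      (λ {J} J∈ → τQ≤GτQ {J} (from (G-τQ J) J∈)))
        where G-τQ = G-τ (τ-pws-isProjection Q uc)

      -- By `G-τ`, `P` coincides with `τ-pws (F Q)` for its projection `Q`. The slices of one world
      -- of `P` make `F Q` universally consistent, so taking slices on both sides identifies `Q`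
      -- with `F Q`.
      projection-isFixpoint : ∀ {P J} → J ∈ worlds P → IsFixpoint _≤ᴷ_ G P →
                              IsFixpoint L._≤_ F (projection P)
      projection-isFixpoint {P} {J₀} J₀∈P (GP≤P , P≤GP) =
        (λ A {I} (J , J∈P , J≈I) → F Q A .respects J≈I (to (∈-τ-pws (F Q) J) (P≤τFQ J∈P) A)) ,
        (λ A I∈FQ → let J , J∈τFQ , J≈I = τ-pws-isProjection (F Q) uc .unslice A I∈FQ
                    in J , P≤GP (from (G-P J) J∈τFQ) , J≈I)
        where
        Q = projection P
        G-P = G-τ (projection-isProjection P)
        P≤τFQ : τ-pws (F Q) ≤ᴷ P
        P≤τFQ J∈P = to (G-P _) (GP≤P J∈P)
        uc : L.UniversallyConsistent (F Q)
        uc A = slice A J₀ , to (∈-τ-pws (F Q) J₀) (P≤τFQ J₀∈P) A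

      isLeastFixpoint-τ : (∀ Q R → Q L.≤ R → F Q L.≤ F R) →
        ∀ Q → L.UniversallyConsistent Q →
        IsLeastFixpoint L._≤_ F Q ⇔ IsLeastFixpoint _≤ᴷ_ G (τ-pws Q)
      isLeastFixpoint-τ mono Q uc = mk⇔
        (λ (fix , least) → to (isFixpoint-τ Q uc) fix , λ P P-fix {J} J∈P →
          -- The given world `J` shows `P` to be nonempty; an empty `P` is above everything.
          from (∈-τ-pws Q J) λ A →
            least _ (projection-isFixpoint J∈P P-fix) A
              (projection-isProjection P .slice-∈ A J∈P))
        (λ (τ-fix , τ-least) →
          let fix   = from (isFixpoint-τ Q uc) τ-fix
              ucₗ   = UniversallyConsistent-≤ lfp Q (lfp-least Q (proj₁ fix)) uc
              -- An arbitrary fixpoint `R` may have empty components, so minimality is used at `lfp`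
              -- and passed on to `R`.
              Q≤lfp = τ-pws-reflects-≤ Q lfp ucₗ λ {J} →
                τ-least (τ-pws lfp) (to (isFixpoint-τ lfp ucₗ) lfp-isFixpoint) {J}
          in fix , λ R R-fix A I∈R → Q≤lfp A (lfp-least R (proj₁ R-fix) A I∈R))
        where open KnasterTarski F mono

    -- Transfer of models

    Stable-τ : ∀ 𝒯 Q R → L.UniversallyConsistent Q → L.UniversallyConsistent R →
               L.Stable 𝒯 Q R ⇔ M.Stable (τ-theory 𝒯) (τ-pws Q) (τ-pws R)
    Stable-τ 𝒯 Q R ucQ ucR = Transfer.isLeastFixpoint-τ
      (λ Q′ → L.Dᶜ 𝒯 Q′ Q) (λ P → M.Dᶜ (τ-theory 𝒯) P (τ-pws Q))
      -- The fixed liberal argument `τ-pws Q` has `Q` as its slices.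
      (λ pr → Dᶜ-τ 𝒯 pr (τ-pws-isProjection Q ucQ)) (λ P P′ → Dᶜ-monoˡ 𝒯 P P′ Q) R ucR

    SupModel-τ : ∀ 𝒯 Q → L.UniversallyConsistent Q →
                 L.SupModel 𝒯 Q ⇔ M.SupModel (τ-theory 𝒯) (τ-pws Q)
    SupModel-τ 𝒯 Q uc =
      Transfer.isFixpoint-τ (L.Dₒₚ 𝒯) (M.Dₒₚ (τ-theory 𝒯)) (Dₒₚ-τ 𝒯) Q uc

    PStModel-τ : ∀ 𝒯 B → L.UniversallyConsistentDBP B →
                 L.PStModel 𝒯 B ⇔ M.PStModel (τ-theory 𝒯) (τ-beliefpair B)
    PStModel-τ 𝒯 B ucˡ = Stable-τ 𝒯 (L.liberal B) (L.conservative B) ucˡ ucᶜ ×-⇔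
      Stable-τ 𝒯 (L.conservative B) (L.liberal B) ucᶜ ucˡ
      where
      ucᶜ : L.UniversallyConsistent (L.conservative B)
      ucᶜ = UniversallyConsistent-≤ (L.conservative B) (L.liberal B) (L.consistent B) ucˡ

mainTheorem3 : ExcludedMiddle (lsuc 0ℓ) →
    (S : Setting) (𝒯 : DAEL.DistributedTheory S) →
    let open Translation S in
    ((Q : DAEL.DPWS S) → DAEL.UniversallyConsistent S Q →
    (DAEL.SupModel S 𝒯 Q ⇔ AEL.SupModel S (τ-theory 𝒯) (τ-pws Q)) ×
    (DAEL.StModel S 𝒯 Q ⇔ AEL.StModel S (τ-theory 𝒯) (τ-pws Q))) ×
    ((B : DAEL.DBP S) → DAEL.UniversallyConsistentDBP S B →
    DAEL.PStModel S 𝒯 B ⇔ AEL.PStModel S (τ-theory 𝒯) (τ-beliefpair B))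
mainTheorem3 em S 𝒯 =
  -- Both components of the translated exact pair are definitionally `τ-pws Q`, so stable models are
  -- an instance of the partial stable case.
  (λ Q uc → SupModel-τ S em 𝒯 Q uc , PStModel-τ S em 𝒯 (DAEL.exact S Q) uc) ,
  (λ B uc → PStModel-τ S em 𝒯 B uc)
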